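{- Let $t(i,j)=r(2^i-2+j)$ for integers $i\geq 0$ and $1\leq j\leq 2^i$, where $r(n)$ is the largest number of red internal nodes in a red-black tree on $n$ keys. Then $$t(i,j)=\begin{cases} i & i<2,\\ \xi(i) & 2\leq i,\ j=1,\\ t(i-1,j)+\xi(i-1) & 2\leq i,\ 2\leq j\leq 2^{i-1},\\ 2^i-1 & 2\leq i,\ j=2^{i-1}+1,\\ t(i-1,j-2^{i-1})+\eta(i) & 2\leq i,\ 2^{i-1}+2\leq j\leq 2^i,\end{cases}$$ where $$\xi(i)=\frac23\left(2^i-\frac{3+(-1)^i}{4}\right)=\left\lceil\frac23(2^i-1)\right\rceil,\qquad \eta(i)=\frac13\left(2^{i+1}+(-1)^i\right)=\left\lfloor\frac13(2^{i+1}+1)\right\rfloor.$$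
   Context: A (relaxed) red-black tree on $n$ keys is a binary search tree with $n$ internal nodes (the nodes holding keys), in which every missing child is regarded as a leaf (NIL), together with a coloring of its nodes such that: each node is either red or black; all leaves (NIL) are black; every red node has two black children (NIL leaves count as black); and, for every node, every path from that node to a descendant leaf contains the same number of black nodes. The root may be red or black. $r(n)$ denotes the maximum, over all red-black trees on $n$ keys, of the number of red internal nodes; $r(0)=0$ (the empty tree, a single NIL leaf). The array $t(i,j)$ lists the sequence $r(0),r(1),r(2),\dots$ row by row, row $i$ having $2^i$ entries: row $0$ is $r(0)$, row $1$ is $r(1),r(2)$, row $2$ is $r(3),\dots,r(6)$, and so on. -}

module Defs where

open import Data.Integer as ℤ using (+_; -1ℤ)
open import Data.Nat
  using (ℕ; _+_; _∸_; _^_; _≤_; _<_)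
open import Data.Nat.Properties using (≤-antisym)
open import Data.Product using (∃-syntax; _×_; _,_; proj₂)
open import Data.Rational as ℚ using (ℚ; _/_)
open import Data.Rational.Literals using (fromℤ)
open import Data.Tree.Binary using (Tree; leaf; node; #nodes)
open import Data.Tree.Binary.Relation.Unary.All using (All)
open import Data.Unit using (⊤)
open import Function using (_∘_)
open import Relation.Binary.PropositionalEquality using (_≡_; refl)
open import Relation.Unary using (Pred; U)

data Color : Set where
  red black : Color

-- Internal nodes carry a colour and a key.  The leaves are the NILs; they
-- carry no data and are black by definition (see `color`).
ColoredTree : Set
ColoredTree = Tree (Color × ℕ) ⊤

color : ColoredTree → Color
color (leaf _)           = black
color (node _ (c , _) _) = c

-- s ⊑ t : s is the subtree of t rooted at some node of t (possibly a NIL).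
data _⊑_ (s : ColoredTree) : ColoredTree → Set where
  here  : s ⊑ s
  left  : ∀ {l x r} → s ⊑ l → s ⊑ node l x r
  right : ∀ {l x r} → s ⊑ r → s ⊑ node l x r

AllKeys : Pred ℕ _ → ColoredTree → Set
AllKeys P = All (P ∘ proj₂) U

IsBST : ColoredTree → Set
IsBST t = ∀ {l c k r} → node l (c , k) r ⊑ t →
  AllKeys (_< k) l × AllKeys (k <_) r

data LeafPath : ColoredTree → Set where
  stop : ∀ {u} → LeafPath (leaf u)
  goˡ  : ∀ {l x r} → LeafPath l → LeafPath (node l x r)
  goʳ  : ∀ {l x r} → LeafPath r → LeafPath (node l x r)

one-if-black : Color → ℕ
one-if-black red   = 0
one-if-black black = 1

one-if-red : Color → ℕ
one-if-red red   = 1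
one-if-red black = 0

-- Both endpoints of the path are counted, including the final NIL.
#blacks : ∀ {t} → LeafPath t → ℕ
#blacks {t} stop    = one-if-black (color t)
#blacks {t} (goˡ p) = one-if-black (color t) + #blacks p
#blacks {t} (goʳ p) = one-if-black (color t) + #blacks p

record IsRedBlack (t : ColoredTree) : Set where
  field
    isBST       : IsBST t
    redChildren : ∀ {l k r} → node l (red , k) r ⊑ t →
                  color l ≡ black × color r ≡ black
    balanced    : ∀ {s} → s ⊑ t → (p q : LeafPath s) → #blacks p ≡ #blacks q

#reds : ColoredTree → ℕ
#reds (leaf _)           = 0
#reds (node l (c , _) r) = #reds l + one-if-red c + #reds r

RedBlackTreeOn : ℕ → ColoredTree → Set
RedBlackTreeOn n t = IsRedBlack t × #nodes t ≡ n

IsMaxReds : ℕ → ℕ → Set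
IsMaxReds n m =
  (∃[ t ] RedBlackTreeOn n t × #reds t ≡ m) ×
  (∀ t → RedBlackTreeOn n t → #reds t ≤ m)

-- Hence at most one function r satisfies ∀ n → IsMaxReds n (r n).
IsMaxReds-unique : ∀ {n m m′} → IsMaxReds n m → IsMaxReds n m′ → m ≡ m′
IsMaxReds-unique ((t , rb , refl) , ub) ((t′ , rb′ , refl) , ub′) =
  ≤-antisym (ub′ t rb) (ub t′ rb′)

-- The subtraction comes last because 2 ^ 0 ∸ 2 would truncate.
rows : (ℕ → ℕ) → ℕ → ℕ → ℕ
rows r i j = r (2 ^ i + j ∸ 2)

fromℕ : ℕ → ℚ
fromℕ n = fromℤ (+ n)

ξ : ℕ → ℚ
ξ i = (+ 2 / 3) ℚ.* (fromℕ (2 ^ i) ℚ.- ((+ 3 ℤ.+ -1ℤ ℤ.^ i) / 4))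

η : ℕ → ℚ
η i = (+ 1 / 3) ℚ.* fromℤ (+ (2 ^ (i + 1)) ℤ.+ -1ℤ ℤ.^ i)

{-# OPTIONS --safe #-}

-- Contracting the lowest black nodes of a red-black tree with L leaves, each with its red
-- children, gives a red-black tree with L′ leaves, L/4 ≤ L′ ≤ L/2, and L - 2 L′ fewer red
-- nodes; conversely, every tree with such an L′ grows back at its leaves to one with L.
-- Since one more key adds at most one red node to the maximum, taking L′ = ⌈L/4⌉ is
-- optimal, which gives r(4q + s) = 2q + s - 1 + r(q) for s < 4 and 4q + s ≥ 2.  The table
-- then follows by induction on the row in steps of two, two rows being one base 4 digit
-- of n.

module Submission where

open import Defs
open import Data.Integer as ℤ using (ℤ; +_; -1ℤ; 1ℤ)
import Data.Integer.DivMod as ℤ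
import Data.Integer.Properties as ℤ
open import Data.Integer.Tactic.RingSolver using () renaming (solve-∀ to ℤ-solve-∀)
open import Data.Nat as ℕ
  using (ℕ; zero; suc; _+_; _*_; _∸_; _^_; _≤_; _<_; _⊓_; z≤n; s≤s; s≤s⁻¹; z<s; s<s)
open import Data.Nat.DivMod
  using (m/n<m; m%n<n; m≡m%n+[m/n]*n; m<n⇒m/n≡0; m*n/n≡m; +-distrib-/-∣ʳ)
open import Data.Nat.Divisibility using (n∣m*n)
open import Data.Nat.Induction using (<-rec)
open import Data.Nat.Properties
open import Data.Nat.Tactic.RingSolver using (solve-∀)
open import Data.Product using (Σ-syntax; ∃-syntax; _×_; _,_; proj₁; proj₂)
open import Data.Rational as ℚ using (ℚ; mkℚ; _/_; floor; ceiling; 0ℚ; 1ℚ)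
open import Data.Rational.Literals using (fromℤ)
import Data.Rational.Properties as ℚ
open import Data.Rational.Solver using (module +-*-Solver)
import Data.Rational.Unnormalised as ℚᵘ
import Data.Rational.Unnormalised.Properties as ℚᵘ
open import Data.Tree.Binary using (leaf; node; #nodes)
open import Data.Tree.Binary.Relation.Unary.All as All using (leaf; node)
open import Data.Unit using (tt)
open import Relation.Binary.PropositionalEquality
  using (_≡_; refl; sym; trans; cong; cong₂; subst; subst₂; module ≡-Reasoning)
open import Relation.Nullary.Decidable using (from-yes)

-- Key-free red-black trees and their extraction from trees with keys.

-- The indices are the root colour and the black height, so the colour and balance conditions hold
-- by construction. The final NIL is not counted in the height, which is why `#blacks` of a path is
-- always `suc h`.
data Shape : Color → ℕ → Set where
  nil       : Shape black 0
  redNode   : ∀ {h} → Shape black h → Shape black h → Shape red h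
  blackNode : ∀ {c d h} → Shape c h → Shape d h → Shape black (suc h)

leaves : ∀ {c h} → Shape c h → ℕ
leaves nil             = 1
leaves (redNode l r)   = leaves l + leaves r
leaves (blackNode l r) = leaves l + leaves r

reds : ∀ {c h} → Shape c h → ℕ
reds nil             = 0
reds (redNode l r)   = reds l + 1 + reds r
reds (blackNode l r) = reds l + 0 + reds r

leaves>0 : ∀ {c h} (t : Shape c h) → 0 < leaves t
leaves>0 nil             = z<s
leaves>0 (redNode l _)   = m≤n⇒m≤n+o _ (leaves>0 l)
leaves>0 (blackNode l _) = m≤n⇒m≤n+o _ (leaves>0 l)

-- A sample path is carried along because `balanced` speaks only of paths: extending the sample
-- paths of two siblings to their parent is what shows that their black heights agree.
record ShapeOf (t : ColoredTree) (c : Color) (h : ℕ) : Set where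
  field
    shape       : Shape c h
    color-eq    : color t ≡ c
    leaves-suc  : leaves shape ≡ suc (#nodes t)
    reds-eq     : reds shape ≡ #reds t
    path        : LeafPath t
    path-height : #blacks path ≡ suc h

open ShapeOf

leaves-node : ∀ {a b m n} → a ≡ suc m → b ≡ suc n → a + b ≡ suc (m + suc n)
leaves-node refl refl = refl

subtreeˡ : ∀ {l x r} → IsRedBlack (node l x r) → IsRedBlack l
subtreeˡ rb = record
  { isBST       = λ s → isBST (left s)
  ; redChildren = λ s → redChildren (left s)
  ; balanced    = λ s → balanced (left s)
  } where open IsRedBlack rb

subtreeʳ : ∀ {l x r} → IsRedBlack (node l x r) → IsRedBlack r
subtreeʳ rb = record
  { isBST       = λ s → isBST (right s)
  ; redChildren = λ s → redChildren (right s)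
  ; balanced    = λ s → balanced (right s)
  } where open IsRedBlack rb

heights-agree : ∀ {l x r c d h h′} → IsRedBlack (node l x r) →
  ShapeOf l c h → ShapeOf r d h′ → h ≡ h′
heights-agree {x = c , _} {h = h} {h′} rb u v = suc-injective (begin
  suc h             ≡⟨ path-height u ⟨
  #blacks (path u)  ≡⟨ +-cancelˡ-≡ (one-if-black c) _ _
                         (IsRedBlack.balanced rb here (goˡ (path u)) (goʳ (path v))) ⟩
  #blacks (path v)  ≡⟨ path-height v ⟩
  suc h′            ∎)
  where open ≡-Reasoning

shapeOf : ∀ t → IsRedBlack t → ∃[ c ] ∃[ h ] ShapeOf t c h
shapeOf (leaf _) _ = black , 0 , record
  { shape = nil ; color-eq = refl ; leaves-suc = refl ; reds-eq = refl
  ; path = stop ; path-height = refl }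
shapeOf (node l x r) rb with shapeOf l (subtreeˡ rb) | shapeOf r (subtreeʳ rb)
... | c , h , u | d , h′ , v with heights-agree rb u v
shapeOf (node l (black , _) r) rb | c , h , u | d , h , v | refl = black , suc h , record
  { shape       = blackNode (shape u) (shape v)
  ; color-eq    = refl
  ; leaves-suc  = leaves-node (leaves-suc u) (leaves-suc v)
  ; reds-eq     = cong₂ (λ a b → a + 0 + b) (reds-eq u) (reds-eq v)
  ; path        = goˡ (path u)
  ; path-height = cong suc (path-height u)
  }
shapeOf (node l (red , _) r) rb | c , h , u | d , h , v | refl
  with IsRedBlack.redChildren rb here
... | l-black , r-black with trans (sym (color-eq u)) l-black | trans (sym (color-eq v)) r-black
...   | refl | refl = red , h , record
  { shape       = redNode (shape u) (shape v)
  ; color-eq    = refl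
  ; leaves-suc  = leaves-node (leaves-suc u) (leaves-suc v)
  ; reds-eq     = cong₂ (λ a b → a + 1 + b) (reds-eq u) (reds-eq v)
  ; path        = goˡ (path u)
  ; path-height = path-height u
  }

-- Filling a shape with keys in symmetric order.

-- The keys below t are the integers strictly between o and o + leaves t.
toTree : ∀ {c h} → ℕ → Shape c h → ColoredTree
toTree o nil             = leaf tt
toTree o (redNode l r)   = node (toTree o l) (red , o + leaves l) (toTree (o + leaves l) r)
toTree o (blackNode l r) = node (toTree o l) (black , o + leaves l) (toTree (o + leaves l) r)

color-toTree : ∀ {c h} o (t : Shape c h) → color (toTree o t) ≡ c
color-toTree o nil             = refl
color-toTree o (redNode _ _)   = refl
color-toTree o (blackNode _ _) = refl

#nodes-toTree : ∀ {c h} o (t : Shape c h) → leaves t ≡ suc (#nodes (toTree o t))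
#nodes-toTree o nil             = refl
#nodes-toTree o (redNode l r)   = leaves-node (#nodes-toTree o l) (#nodes-toTree _ r)
#nodes-toTree o (blackNode l r) = leaves-node (#nodes-toTree o l) (#nodes-toTree _ r)

#reds-toTree : ∀ {c h} o (t : Shape c h) → #reds (toTree o t) ≡ reds t
#reds-toTree o nil = refl
#reds-toTree o (redNode l r) =
  cong₂ (λ a b → a + 1 + b) (#reds-toTree o l) (#reds-toTree _ r)
#reds-toTree o (blackNode l r) =
  cong₂ (λ a b → a + 0 + b) (#reds-toTree o l) (#reds-toTree _ r)

#blacks-toTree : ∀ {c h} o (t : Shape c h) (p : LeafPath (toTree o t)) → #blacks p ≡ suc h
#blacks-toTree o nil             stop    = refl
#blacks-toTree o (redNode l r)   (goˡ p) = #blacks-toTree o l p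
#blacks-toTree o (redNode l r)   (goʳ p) = #blacks-toTree _ r p
#blacks-toTree o (blackNode l r) (goˡ p) = cong suc (#blacks-toTree o l p)
#blacks-toTree o (blackNode l r) (goʳ p) = cong suc (#blacks-toTree _ r p)

join-keys : ∀ {l c r} o m n → 0 < m → 0 < n →
  AllKeys (λ k → o < k × k < o + m) l →
  AllKeys (λ k → o + m < k × k < o + m + n) r →
  AllKeys (λ k → o < k × k < o + (m + n)) (node l (c , o + m) r)
join-keys {l} {c} {r} o m n 0<m 0<n kl kr =
  subst (λ e → AllKeys (λ k → o < k × k < e) (node l (c , o + m) r)) (+-assoc o m n)
    (node (All.mapₙ (λ { (a , b) → a , m≤n⇒m≤n+o n b }) kl)
          (m<m+n o 0<m , m<m+n (o + m) 0<n)
          (All.mapₙ (λ { (a , b) → ≤-<-trans (m≤m+n o m) a , b }) kr))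

keys-toTree : ∀ {c h} o (t : Shape c h) →
  AllKeys (λ k → o < k × k < o + leaves t) (toTree o t)
keys-toTree o nil             = leaf _
keys-toTree o (redNode l r)   =
  join-keys o _ _ (leaves>0 l) (leaves>0 r) (keys-toTree o l) (keys-toTree _ r)
keys-toTree o (blackNode l r) =
  join-keys o _ _ (leaves>0 l) (leaves>0 r) (keys-toTree o l) (keys-toTree _ r)

isBST-toTree : ∀ {c h} o (t : Shape c h) → IsBST (toTree o t)
isBST-toTree o (redNode l r) here =
  All.mapₙ proj₂ (keys-toTree o l) , All.mapₙ proj₁ (keys-toTree _ r)
isBST-toTree o (redNode l r) (left s)  = isBST-toTree o l s
isBST-toTree o (redNode l r) (right s) = isBST-toTree _ r s
isBST-toTree o (blackNode l r) here =
  All.mapₙ proj₂ (keys-toTree o l) , All.mapₙ proj₁ (keys-toTree _ r)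
isBST-toTree o (blackNode l r) (left s)  = isBST-toTree o l s
isBST-toTree o (blackNode l r) (right s) = isBST-toTree _ r s

redChildren-toTree : ∀ {c h} o (t : Shape c h) {l k r} → node l (red , k) r ⊑ toTree o t →
  color l ≡ black × color r ≡ black
redChildren-toTree o (redNode l r)   here      = color-toTree o l , color-toTree _ r
redChildren-toTree o (redNode l r)   (left s)  = redChildren-toTree o l s
redChildren-toTree o (redNode l r)   (right s) = redChildren-toTree _ r s
redChildren-toTree o (blackNode l r) (left s)  = redChildren-toTree o l s
redChildren-toTree o (blackNode l r) (right s) = redChildren-toTree _ r s

balanced-toTree : ∀ {c h} o (t : Shape c h) {s} → s ⊑ toTree o t →
  (p q : LeafPath s) → #blacks p ≡ #blacks q
balanced-toTree o nil here p q =
  trans (#blacks-toTree o nil p) (sym (#blacks-toTree o nil q))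
balanced-toTree o t@(redNode _ _) here p q =
  trans (#blacks-toTree o t p) (sym (#blacks-toTree o t q))
balanced-toTree o t@(blackNode _ _) here p q =
  trans (#blacks-toTree o t p) (sym (#blacks-toTree o t q))
balanced-toTree o (redNode l r)   (left s)  = balanced-toTree o l s
balanced-toTree o (redNode l r)   (right s) = balanced-toTree _ r s
balanced-toTree o (blackNode l r) (left s)  = balanced-toTree o l s
balanced-toTree o (blackNode l r) (right s) = balanced-toTree _ r s

toTree-isRedBlack : ∀ {c h} o (t : Shape c h) → IsRedBlack (toTree o t)
toTree-isRedBlack o t = record
  { isBST       = isBST-toTree o t
  ; redChildren = redChildren-toTree o t
  ; balanced    = balanced-toTree o t
  }

-- Contracting and growing the lowest black level.

-- Contracts the lowest level of black nodes, each together with its red children: a black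
-- node with g ∈ {2, 3, 4} leaves below it becomes a single leaf and g - 2 red nodes vanish.
strip : ∀ {c h} → Shape c (suc h) → Shape c h
strip             (redNode l r)   = redNode (strip l) (strip r)
strip {h = zero}  (blackNode l r) = nil
strip {h = suc _} (blackNode l r) = blackNode (strip l) (strip r)

leaves-0≤2 : ∀ {c} (t : Shape c 0) → leaves t ≤ 2
leaves-0≤2 nil               = s≤s z≤n
leaves-0≤2 (redNode nil nil) = ≤-refl

-- Each leaf of `strip t` replaces a black node whose two children have black height 0, hence at
-- most two leaves each.
leaves≤4*strip : ∀ {c h} (t : Shape c (suc h)) → leaves t ≤ 4 * leaves (strip t)
leaves≤4*strip {h = zero}  (blackNode l r) = +-mono-≤ (leaves-0≤2 l) (leaves-0≤2 r)
leaves≤4*strip {h = suc _} (blackNode l r) =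
  ≤-trans (+-mono-≤ (leaves≤4*strip l) (leaves≤4*strip r))
          (≤-reflexive (sym (*-distribˡ-+ 4 (leaves (strip l)) _)))
leaves≤4*strip (redNode l r) =
  ≤-trans (+-mono-≤ (leaves≤4*strip l) (leaves≤4*strip r))
          (≤-reflexive (sym (*-distribˡ-+ 4 (leaves (strip l)) _)))

suc-reds-0 : ∀ {c} (t : Shape c 0) → reds t + 1 ≡ leaves t
suc-reds-0 nil               = refl
suc-reds-0 (redNode nil nil) = refl

private
  reds-strip-join : ∀ {c d h} e (l : Shape c (suc h)) (r : Shape d (suc h)) →
    reds l + 2 * leaves (strip l) ≡ reds (strip l) + leaves l →
    reds r + 2 * leaves (strip r) ≡ reds (strip r) + leaves r →
    reds l + e + reds r + 2 * (leaves (strip l) + leaves (strip r)) ≡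
    reds (strip l) + e + reds (strip r) + (leaves l + leaves r)
  reds-strip-join e l r p q = begin
    reds l + e + reds r + 2 * (leaves (strip l) + leaves (strip r))
      ≡⟨ lhs (reds l) (leaves (strip l)) (reds r) (leaves (strip r)) e ⟩
    (reds l + 2 * leaves (strip l)) + (reds r + 2 * leaves (strip r)) + e
      ≡⟨ cong₂ (λ x y → x + y + e) p q ⟩
    (reds (strip l) + leaves l) + (reds (strip r) + leaves r) + e
      ≡⟨ rhs (reds (strip l)) (leaves l) (reds (strip r)) (leaves r) e ⟩
    reds (strip l) + e + reds (strip r) + (leaves l + leaves r) ∎
    where
    open ≡-Reasoning
    lhs : ∀ a b a′ b′ e →
      a + e + a′ + 2 * (b + b′) ≡ (a + 2 * b) + (a′ + 2 * b′) + e
    lhs = solve-∀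
    rhs : ∀ c d c′ d′ e → (c + d) + (c′ + d′) + e ≡ c + e + c′ + (d + d′)
    rhs = solve-∀

  bottom-count : ∀ a b → a + 0 + b + 2 ≡ (a + 1) + (b + 1)
  bottom-count = solve-∀

-- Sums the loss of g - 2 red nodes over all contracted black nodes, the values g adding up to
-- `leaves t`. The additive form avoids truncated subtraction.
reds-strip : ∀ {c h} (t : Shape c (suc h)) →
  reds t + 2 * leaves (strip t) ≡ reds (strip t) + leaves t
reds-strip {h = zero} (blackNode l r) =
  trans (bottom-count (reds l) (reds r)) (cong₂ _+_ (suc-reds-0 l) (suc-reds-0 r))
reds-strip {h = suc _} (blackNode l r) =
  reds-strip-join 0 l r (reds-strip l) (reds-strip r)
reds-strip (redNode l r) =
  reds-strip-join 1 l r (reds-strip l) (reds-strip r)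

-- Two leaves in place of each old one are the minimum; every one of the `e` leaves beyond that is
-- paid for by exactly one new red node.
Grown : ∀ {c h} → Shape c h → ℕ → Set
Grown {c} {h} t e =
  Σ[ u ∈ Shape c (suc h) ] leaves u ≡ e + 2 * leaves t × reds u ≡ e + reds t

private
  grown-leaves : ∀ d e m n → (d + 2 * m) + (e + 2 * n) ≡ d + e + 2 * (m + n)
  grown-leaves = solve-∀

  grown-reds : ∀ d e m n k → (d + m) + k + (e + n) ≡ d + e + (m + k + n)
  grown-reds = solve-∀

  -- The surplus e is shared out greedily, the left subtree first.
  share : ∀ {e} m n → e ≤ 2 * (m + n) →
    ∃[ d ] ∃[ d′ ] d ≤ 2 * m × d′ ≤ 2 * n × d + d′ ≡ e
  share {e} m n e≤ =
    2 * m ⊓ e , e ∸ 2 * m , m⊓n≤m (2 * m) e ,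
    m≤n+o⇒m∸n≤o e (2 * m) (subst (e ≤_) (*-distribˡ-+ 2 m n) e≤) , m⊓n+n∸m≡n (2 * m) e

-- Each NIL becomes a black node with 0, 1 or 2 red children, so it can absorb a surplus of up to 2.
-- The new node is black like the NIL it replaces, so the colour index of every subtree survives.
grow : ∀ {c h} (t : Shape c h) e → e ≤ 2 * leaves t → Grown t e
grow nil 0 _ = blackNode nil nil , refl , refl
grow nil 1 _ = blackNode (redNode nil nil) nil , refl , refl
grow nil 2 _ = blackNode (redNode nil nil) (redNode nil nil) , refl , refl
grow nil (suc (suc (suc _))) (s≤s (s≤s ()))
grow (redNode l r) e e≤ with share (leaves l) (leaves r) e≤
... | d , d′ , d≤ , d′≤ , refl with grow l d d≤ | grow r d′ d′≤
...   | u , lu , ru | v , lv , rv =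
  redNode u v ,
  trans (cong₂ _+_ lu lv) (grown-leaves d d′ (leaves l) (leaves r)) ,
  trans (cong₂ (λ a b → a + 1 + b) ru rv) (grown-reds d d′ (reds l) (reds r) 1)
grow (blackNode l r) e e≤ with share (leaves l) (leaves r) e≤
... | d , d′ , d≤ , d′≤ , refl with grow l d d≤ | grow r d′ d′≤
...   | u , lu , ru | v , lv , rv =
  blackNode u v ,
  trans (cong₂ _+_ lu lv) (grown-leaves d d′ (leaves l) (leaves r)) ,
  trans (cong₂ (λ a b → a + 0 + b) ru rv) (grown-reds d d′ (reds l) (reds r) 0)

-- The base 4 recursion for the maximum.

-- In terms of the L = n + 1 leaves, n / 4 is ⌈L/4⌉ - 1 and the first summand is L - 2 ⌈L/4⌉.
maxRedsWithin : ℕ → ℕ → ℕ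
maxRedsWithin zero       _               = 0
maxRedsWithin (suc fuel) 0               = 0
maxRedsWithin (suc fuel) 1               = 1
maxRedsWithin (suc fuel) n@(suc (suc m)) =
  (suc m ∸ 2 * (n ℕ./ 4)) + maxRedsWithin fuel (n ℕ./ 4)

maxReds : ℕ → ℕ
maxReds n = maxRedsWithin n n

private
  quarter≤ : ∀ m → suc (suc m) ℕ./ 4 ≤ suc m
  quarter≤ m = s≤s⁻¹ (m/n<m (suc (suc m)) 4 (s<s z<s))

-- For arguments from 2 on, a recursive call lowers the fuel by one and the argument by at least
-- one, so fuel that starts at or above the argument never runs out.
maxRedsWithin-enough : ∀ f g n → n ≤ f → n ≤ g → maxRedsWithin f n ≡ maxRedsWithin g n
maxRedsWithin-enough zero    zero    n             _        _        = refl
maxRedsWithin-enough zero    (suc g) 0             _        _        = refl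
maxRedsWithin-enough (suc f) zero    0             _        _        = refl
maxRedsWithin-enough (suc f) (suc g) 0             _        _        = refl
maxRedsWithin-enough (suc f) (suc g) 1             _        _        = refl
maxRedsWithin-enough (suc f) (suc g) (suc (suc m)) (s≤s n≤f) (s≤s n≤g) =
  cong (λ x → suc m ∸ 2 * (suc (suc m) ℕ./ 4) + x)
    (maxRedsWithin-enough f g _ (≤-trans (quarter≤ m) n≤f) (≤-trans (quarter≤ m) n≤g))

quarter : ∀ {s} q → s < 4 → (s + q * 4) ℕ./ 4 ≡ q
quarter {s} q s<4 = begin
  (s + q * 4) ℕ./ 4      ≡⟨ +-distrib-/-∣ʳ s (n∣m*n q) ⟩
  s ℕ./ 4 + (q * 4) ℕ./ 4  ≡⟨ cong₂ _+_ (m<n⇒m/n≡0 s<4) (m*n/n≡m q 4) ⟩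
  q                    ∎
  where open ≡-Reasoning

2q≤n∸1 : ∀ s q {m} → suc (suc m) ≡ s + q * 4 → 2 * q ≤ suc m
2q≤n∸1 s zero    _  = z≤n
2q≤n∸1 s (suc q) eq = s≤s⁻¹ (begin
  suc (2 * suc q)            ≤⟨ m≤m+n _ (suc (2 * q) + s) ⟩
  suc (2 * suc q) + (suc (2 * q) + s) ≡⟨ regroup s q ⟩
  s + suc q * 4              ≡⟨ eq ⟨
  _                          ∎)
  where
  open ≤-Reasoning
  regroup : ∀ s q → suc (2 * suc q) + (suc (2 * q) + s) ≡ s + suc q * 4
  regroup = solve-∀

-- With n = 4q + s the quotient is q, and n - 1 - 2q = s + 2q - 1. The `suc` on the left absorbs the
-- -1; `2q≤n∸1` shows that the subtraction does not truncate.
maxReds-quarter : ∀ s q → s < 4 → 2 ≤ s + q * 4 →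
  suc (maxReds (s + q * 4)) ≡ s + 2 * q + maxReds q
maxReds-quarter s q s<4 2≤n = go (s + q * 4) refl 2≤n
  where
  open ≡-Reasoning
  regroup : ∀ s q → s + q * 4 ≡ (s + 2 * q) + 2 * q
  regroup = solve-∀
  go : ∀ n → n ≡ s + q * 4 → 2 ≤ n → suc (maxReds n) ≡ s + 2 * q + maxReds q
  go 1             _  (s≤s ())
  go (suc (suc m)) eq _ = begin
    suc (suc m ∸ 2 * (n ℕ./ 4)) + maxRedsWithin (suc m) (n ℕ./ 4)
      ≡⟨ cong (λ x → suc (suc m ∸ 2 * x) + maxRedsWithin (suc m) x) n/4≡q ⟩
    suc (suc m ∸ 2 * q) + maxRedsWithin (suc m) q
      ≡⟨ cong₂ _+_ (sym (+-∸-assoc 1 (2q≤n∸1 s q eq)))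
           (maxRedsWithin-enough (suc m) q q q≤ ≤-refl) ⟩
    (n ∸ 2 * q) + maxReds q
      ≡⟨ cong (λ x → x ∸ 2 * q + maxReds q) (trans eq (regroup s q)) ⟩
    ((s + 2 * q) + 2 * q ∸ 2 * q) + maxReds q
      ≡⟨ cong (_+ maxReds q) (m+n∸n≡m (s + 2 * q) (2 * q)) ⟩
    s + 2 * q + maxReds q ∎
    where
    n = suc (suc m)
    n/4≡q : n ℕ./ 4 ≡ q
    n/4≡q = trans (cong (ℕ._/ 4) eq) (quarter q s<4)
    q≤ : q ≤ suc m
    q≤ = subst (_≤ suc m) n/4≡q (quarter≤ m)

data Quartered : ℕ → Set where
  quartered : ∀ s q → s < 4 → Quartered (s + q * 4)

quarters : ∀ n → Quartered n
quarters n = subst Quartered (sym (m≡m%n+[m/n]*n n 4))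
  (quartered (n ℕ.% 4) (n ℕ./ 4) (m%n<n n 4))

quotient<n : ∀ s q → 2 ≤ s + q * 4 → q < s + q * 4
quotient<n s zero    2≤n = ≤-trans (s≤s z≤n) 2≤n
quotient<n s (suc q) _   = begin-strict
  suc q              <⟨ m<m+n (suc q) z<s ⟩
  suc q + (suc q * 3) ≡⟨ *-suc (suc q) 3 ⟨
  suc q * 4          ≤⟨ m≤n+m (suc q * 4) s ⟩
  s + suc q * 4      ∎
  where open ≤-Reasoning

<4-elim : (P : ℕ → Set) → P 0 → P 1 → P 2 → P 3 → ∀ {s} → s < 4 → P s
<4-elim P p₀ p₁ p₂ p₃ {0} _ = p₀
<4-elim P p₀ p₁ p₂ p₃ {1} _ = p₁
<4-elim P p₀ p₁ p₂ p₃ {2} _ = p₂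
<4-elim P p₀ p₁ p₂ p₃ {3} _ = p₃
<4-elim P p₀ p₁ p₂ p₃ {suc (suc (suc (suc _)))} (s≤s (s≤s (s≤s (s≤s ()))))

-- Induction on base 4 digits. The arguments 0 and 1 are exactly those that `maxReds-quarter` leaves
-- out.
quarter-rec : (P : ℕ → Set) → P 0 → P 1 →
  (∀ s q → s < 4 → 2 ≤ s + q * 4 → P q → P (s + q * 4)) → ∀ n → P n
quarter-rec P p₀ p₁ step = <-rec P λ n rec → go n rec (quarters n)
  where
  go : ∀ n → (∀ {m} → m < n → P m) → Quartered n → P n
  go 0             _   _  = p₀
  go 1             _   _  = p₁
  go n@(suc (suc _)) rec qn = big qn rec (s≤s (s≤s z≤n))
    where
    -- The index is a variable again here: matching `quartered` against `suc (suc _)` would require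
    -- unifying it with `s + q * 4`.
    big : ∀ {n} → Quartered n → (∀ {m} → m < n → P m) → 2 ≤ n → P n
    big (quartered s q s<4) rec 2≤n = step s q s<4 2≤n (rec (quotient<n s q 2≤n))

-- Raising the last base 4 digit without a carry adds exactly one. On a carry the digit sum term
-- drops from 3 + 2q to 2 + 2q while `maxReds q` grows by at most one, so the value does not grow at
-- all.
maxReds-suc : ∀ n → maxReds (suc n) ≤ suc (maxReds n)
maxReds-suc = quarter-rec (λ n → maxReds (suc n) ≤ suc (maxReds n)) (s≤s z≤n) (s≤s z≤n) step
  where
  open ≤-Reasoning
  within : ∀ s q → suc s < 4 → 2 ≤ s + q * 4 →
    maxReds (suc (s + q * 4)) ≤ suc (maxReds (s + q * 4))
  within s q s+1<4 2≤n = ≤-reflexive (suc-injective (begin-equality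
    suc (maxReds (suc s + q * 4))   ≡⟨ maxReds-quarter (suc s) q s+1<4 (m≤n⇒m≤1+n 2≤n) ⟩
    suc (s + 2 * q + maxReds q)     ≡⟨ cong suc (maxReds-quarter s q (<⇒≤ s+1<4) 2≤n) ⟨
    suc (suc (maxReds (s + q * 4))) ∎))

  across : ∀ q → maxReds (suc q) ≤ suc (maxReds q) →
    maxReds (4 + q * 4) ≤ suc (maxReds (3 + q * 4))
  across q ih = m≤n⇒m≤1+n (s≤s⁻¹ (begin
    suc (maxReds (suc q * 4))   ≡⟨ maxReds-quarter 0 (suc q) z<s (s≤s (s≤s z≤n)) ⟩
    2 * suc q + maxReds (suc q) ≤⟨ +-monoʳ-≤ (2 * suc q) ih ⟩
    2 * suc q + suc (maxReds q) ≡⟨ regroup q (maxReds q) ⟩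
    3 + 2 * q + maxReds q       ≡⟨ maxReds-quarter 3 q ≤-refl (s≤s (s≤s z≤n)) ⟨
    suc (maxReds (3 + q * 4))   ∎))
    where
    regroup : ∀ q x → 2 * suc q + suc x ≡ 3 + 2 * q + x
    regroup = solve-∀

  step : ∀ s q → s < 4 → 2 ≤ s + q * 4 → maxReds (suc q) ≤ suc (maxReds q) →
    maxReds (suc (s + q * 4)) ≤ suc (maxReds (s + q * 4))
  step s q s<4 2≤n ih = <4-elim
    (λ s → 2 ≤ s + q * 4 → maxReds (suc (s + q * 4)) ≤ suc (maxReds (s + q * 4)))
    (within 0 q (s≤s (s≤s z≤n))) (within 1 q (s≤s (s≤s (s≤s z≤n)))) (within 2 q ≤-refl)
    (λ _ → across q ih) s<4 2≤n

maxReds-+ : ∀ k n → maxReds (k + n) ≤ k + maxReds n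
maxReds-+ zero    n = ≤-refl
maxReds-+ (suc k) n = ≤-trans (maxReds-suc (k + n)) (s≤s (maxReds-+ k n))

-- Values of the maximum in terms of leading binary digits.

-- The integer values of `ξ`: 0, 1, 2, 5, 10, 21, ..., in binary the alternating words 1, 10, 101,
-- 1010, ....
ξℕ : ℕ → ℕ
ξℕ 0             = 0
ξℕ 1             = 1
ξℕ (suc (suc i)) = 2 ^ suc i + ξℕ i

-- The integer values of `η`: 1, 1, 3, 5, 11, ..., the Jacobsthal numbers without their initial 0.
ηℕ : ℕ → ℕ
ηℕ 0             = 1
ηℕ 1             = 1
ηℕ (suc (suc i)) = 2 ^ suc i + ηℕ i

-- Splitting off the two lowest binary digits preserves the leading ones, so only p = 0
-- and p = 1 have to be checked; W collects the difference.
maxReds-leading : ∀ b (W : ℕ → ℕ) →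
  maxReds (suc b) ≡ 1 + W 0 →
  maxReds (suc b * 2) ≡ 1 + W 1 →
  maxReds (suc b * 2 + 1) ≡ 2 + W 1 →
  (∀ p → W (2 + p) ≡ 2 ^ suc p * b + W p) →
  ∀ p u → u < 2 ^ p → maxReds (suc b * 2 ^ p + u) ≡ maxReds (2 ^ p + u) + W p
maxReds-leading b W w₀ w₁ w₁′ w = go
  where
  go : ∀ p u → u < 2 ^ p → maxReds (suc b * 2 ^ p + u) ≡ maxReds (2 ^ p + u) + W p
  -- The constants 1, 1 and 2 in the three premises are `maxReds` at 1, 2 and 3, the numbers
  -- `2 ^ p + u` with `p` at most 1.
  go 0 0 _ = trans (cong maxReds (trans (+-identityʳ (suc b * 1)) (*-identityʳ (suc b)))) w₀
  go 0 (suc u) (s≤s ())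
  go 1 0 _ = trans (cong maxReds (+-identityʳ (suc b * 2))) w₁
  go 1 1 _ = w₁′
  go 1 (suc (suc u)) (s≤s (s≤s ()))
  go (suc (suc p)) u u< with quarters u
  ... | quartered s v s<4 = suc-injective (begin
    suc (maxReds (suc b * (2 * (2 * x)) + (s + v * 4)))
      ≡⟨ cong (λ n → suc (maxReds n)) (digits (suc b) x s v) ⟩
    suc (maxReds (s + (suc b * x + v) * 4))
      ≡⟨ maxReds-quarter s (suc b * x + v) s<4 (2≤n (m≤n⇒m≤n+o (b * x) (m^n>0 2 p))) ⟩
    s + 2 * (suc b * x + v) + maxReds (suc b * x + v)
      ≡⟨ cong (λ y → s + 2 * (suc b * x + v) + y) (go p v v<) ⟩
    s + 2 * (suc b * x + v) + (maxReds (x + v) + W p)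
      -- The two quotients by 4 differ by `b * 2 ^ p`, and `maxReds-quarter` counts the quotient
      -- twice; this is the increment `2 ^ suc p * b` of `W`.
      ≡⟨ regroup b x s v (maxReds (x + v)) (W p) ⟩
    (s + 2 * (x + v) + maxReds (x + v)) + (2 ^ suc p * b + W p)
      ≡⟨ cong₂ _+_ (maxReds-quarter s (x + v) s<4 (2≤n (m^n>0 2 p))) (w p) ⟨
    suc (maxReds (s + (x + v) * 4)) + W (2 + p)
      ≡⟨ cong (λ n → suc (maxReds n) + W (2 + p)) (digits′ x s v) ⟨
    suc (maxReds (2 * (2 * x) + (s + v * 4))) + W (2 + p) ∎)
    where
    open ≡-Reasoning
    x = 2 ^ p
    digits : ∀ a x s v → a * (2 * (2 * x)) + (s + v * 4) ≡ s + (a * x + v) * 4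
    digits = solve-∀
    digits′ : ∀ x s v → 2 * (2 * x) + (s + v * 4) ≡ s + (x + v) * 4
    digits′ = solve-∀
    regroup : ∀ b x s v y z → s + 2 * (suc b * x + v) + (y + z) ≡
      (s + 2 * (x + v) + y) + (2 * x * b + z)
    regroup = solve-∀
    2≤n : ∀ {y} → 0 < y → 2 ≤ s + (y + v) * 4
    2≤n {suc y} _ = m≤n⇒m≤o+n s (s≤s (s≤s z≤n))
    -- Dropping the last base 4 digit of `u` keeps the rest below the leading block, as the
    -- induction hypothesis needs.
    v< : v < x
    v< = *-cancelʳ-< 4 v x (≤-<-trans (m≤n+m (v * 4) s) (subst (s + v * 4 <_) (four x) u<))
      where
      four : ∀ x → 2 * (2 * x) ≡ x * 4
      four = solve-∀

-- The effect of deleting the 0 from the leading binary digits 10.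
maxReds-leading-10 : ∀ p u → u < 2 ^ p → maxReds (2 ^ suc p + u) ≡ maxReds (2 ^ p + u) + ξℕ p
maxReds-leading-10 = maxReds-leading 1 ξℕ refl refl refl
  λ p → cong (_+ ξℕ p) (sym (*-identityʳ (2 ^ suc p)))

-- The effect of deleting one 1 from the leading binary digits 11.
maxReds-leading-11 : ∀ p u → u < 2 ^ p →
  maxReds (3 * 2 ^ p + u) ≡ maxReds (2 ^ p + u) + ηℕ (suc p)
maxReds-leading-11 = maxReds-leading 2 (λ p → ηℕ (suc p)) refl refl refl
  λ p → cong (_+ ηℕ (suc p)) (*-comm 2 (2 ^ suc p))

-- 4 * 2^i - 1 = 3 + 4 (2^i - 1): two binary ones split off as the base 4 digit 3.
maxReds-2^i∸1 : ∀ i → maxReds (2 ^ i ∸ 1) ≡ ξℕ i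
maxReds-2^i∸1 0             = refl
maxReds-2^i∸1 1             = refl
maxReds-2^i∸1 (suc (suc i)) with 2 ^ i | m^n>0 2 i | maxReds-2^i∸1 i
... | suc x | _ | ih = suc-injective (begin
  suc (maxReds (2 * (2 * suc x) ∸ 1))  ≡⟨ cong (λ n → suc (maxReds (n ∸ 1))) (digits x) ⟩
  suc (maxReds (3 + x * 4))            ≡⟨ maxReds-quarter 3 x ≤-refl (s≤s (s≤s z≤n)) ⟩
  3 + 2 * x + maxReds x                ≡⟨ cong (λ y → 3 + 2 * x + y) ih ⟩
  3 + 2 * x + ξℕ i                     ≡⟨ regroup x (ξℕ i) ⟩
  suc (2 * suc x + ξℕ i)               ∎)
  where
  open ≡-Reasoning
  digits : ∀ x → 2 * (2 * suc x) ≡ 4 + x * 4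
  digits = solve-∀
  regroup : ∀ x y → 3 + 2 * x + y ≡ suc (2 * suc x + y)
  regroup = solve-∀

-- Alternating binary words of adjacent lengths are complementary, so they add up to `suc i` ones.
ξℕ-adjacent : ∀ i → suc (ξℕ (suc i) + ξℕ i) ≡ 2 ^ suc i
ξℕ-adjacent 0       = refl
ξℕ-adjacent (suc i) = begin
  suc (2 ^ suc i + ξℕ i + ξℕ (suc i))   ≡⟨ regroup (2 ^ suc i) (ξℕ i) (ξℕ (suc i)) ⟩
  2 ^ suc i + suc (ξℕ (suc i) + ξℕ i)   ≡⟨ cong (λ y → 2 ^ suc i + y) (ξℕ-adjacent i) ⟩
  2 ^ suc i + 2 ^ suc i                 ≡⟨ cong (λ y → 2 ^ suc i + y) (+-identityʳ _) ⟨
  2 ^ suc (suc i)                       ∎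
  where
  open ≡-Reasoning
  regroup : ∀ x y z → suc (x + y + z) ≡ x + suc (z + y)
  regroup = solve-∀

-- The argument is 10 followed by `p` ones in binary. Deleting the 0 costs `ξℕ p` and leaves `suc p`
-- ones, worth `ξℕ (suc p)`.
maxReds-middle : ∀ p → maxReds (2 ^ suc p + (2 ^ p ∸ 1)) ≡ 2 ^ suc p ∸ 1
maxReds-middle p = begin
  maxReds (2 ^ suc p + (2 ^ p ∸ 1))
    ≡⟨ maxReds-leading-10 p (2 ^ p ∸ 1) (pred< (2 ^ p) (m^n>0 2 p)) ⟩
  maxReds (2 ^ p + (2 ^ p ∸ 1)) + ξℕ p
    ≡⟨ cong (λ n → maxReds n + ξℕ p) (double (2 ^ p) (m^n>0 2 p)) ⟩
  maxReds (2 ^ suc p ∸ 1) + ξℕ p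
    ≡⟨ cong (_+ ξℕ p) (maxReds-2^i∸1 (suc p)) ⟩
  ξℕ (suc p) + ξℕ p
    ≡⟨ cong (_∸ 1) (ξℕ-adjacent p) ⟩
  2 ^ suc p ∸ 1 ∎
  where
  open ≡-Reasoning
  pred< : ∀ n → 0 < n → n ∸ 1 < n
  pred< (suc n) _ = ≤-refl
  double : ∀ n → 0 < n → n + (n ∸ 1) ≡ 2 * n ∸ 1
  double (suc n) _ = regroup n
    where
    regroup : ∀ n → suc (n + n) ≡ n + suc (n + 0)
    regroup = solve-∀

-- The rational closed forms, floor and ceiling.

fromℤ-+ : ∀ a b → fromℤ (a ℤ.+ b) ≡ fromℤ a ℚ.+ fromℤ b
fromℤ-+ a b = ℚ.toℚᵘ-injective (ℚᵘ.≃-trans (ℚᵘ.*≡* (ring a b))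
  (ℚᵘ.≃-sym (ℚ.toℚᵘ-homo-+ (fromℤ a) (fromℤ b))))
  where
  ring : ∀ a b → (a ℤ.+ b) ℤ.* 1ℤ ≡ (a ℤ.* 1ℤ ℤ.+ b ℤ.* 1ℤ) ℤ.* 1ℤ
  ring = ℤ-solve-∀

fromℕ-+ : ∀ m n → fromℕ (m + n) ≡ fromℕ m ℚ.+ fromℕ n
fromℕ-+ m n = fromℤ-+ (+ m) (+ n)

fromℕ-double : ∀ n → fromℕ (2 * n) ≡ fromℕ n ℚ.+ fromℕ n
fromℕ-double n = trans (fromℕ-+ n (n + 0))
  (cong (fromℕ n ℚ.+_) (trans (fromℕ-+ n 0) (ℚ.+-identityʳ (fromℕ n))))

<suc⇒≤ : ∀ {i j} → i ℤ.< ℤ.suc j → i ℤ.≤ j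
<suc⇒≤ {i} {j} i<1+j = subst (i ℤ.≤_) (ℤ.pred-suc j) (ℤ.i<j⇒i≤pred[j] i<1+j)

-- Over the denominator d, both k and the quotient of the numerator n by d lie in (n/d - 1, n/d];
-- each is therefore less than the successor of the other.
floor-unique : ∀ k p → fromℤ k ℚ.≤ p → p ℚ.< fromℤ (ℤ.suc k) → floor p ≡ k
floor-unique k p@(mkℚ n d-1 _) (ℚ.*≤* k≤p) (ℚ.*<* p<1+k) =
  trans (ℤ.div-pos-is-/ℕ n d) (ℤ.≤-antisym
    (<suc⇒≤ (ℤ.*-cancelʳ-<-nonNeg (+ d) (ℤ.≤-<-trans (ℤ.[n/ℕd]*d≤n n d)
      (subst (ℤ._< ℤ.suc k ℤ.* + d) (ℤ.*-identityʳ n) p<1+k))))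
    (<suc⇒≤ (ℤ.*-cancelʳ-<-nonNeg (+ d) (ℤ.≤-<-trans
      (subst (k ℤ.* + d ℤ.≤_) (ℤ.*-identityʳ n) k≤p) (ℤ.n<s[n/ℕd]*d n d)))))
  where d = suc d-1

floor-+ : ∀ k c → 0ℚ ℚ.≤ c → c ℚ.< 1ℚ → floor (fromℤ k ℚ.+ c) ≡ k
floor-+ k c 0≤c c<1 = floor-unique k (fromℤ k ℚ.+ c)
  (subst (ℚ._≤ fromℤ k ℚ.+ c) (ℚ.+-identityʳ (fromℤ k)) (ℚ.+-monoʳ-≤ (fromℤ k) 0≤c))
  (subst (fromℤ k ℚ.+ c ℚ.<_)
    (trans (ℚ.+-comm (fromℤ k) 1ℚ) (sym (fromℤ-+ 1ℤ k))) (ℚ.+-monoʳ-< (fromℤ k) c<1))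

ceiling-floor : ∀ p → ceiling p ≡ ℤ.- floor (ℚ.- p)
ceiling-floor (mkℚ _ _ _) = refl

sign-period : ∀ i → -1ℤ ℤ.^ (2 + i) ≡ -1ℤ ℤ.^ i
sign-period i = trans (sym (ℤ.*-assoc -1ℤ -1ℤ (-1ℤ ℤ.^ i))) (ℤ.*-identityˡ (-1ℤ ℤ.^ i))

-- Leaves only two closed rational inequalities to check, which the decision procedures then settle
-- by computation.
sign-elim : (P : ℤ → Set) → P 1ℤ → P -1ℤ → ∀ i → P (-1ℤ ℤ.^ i)
sign-elim P p⁺ p⁻ 0             = p⁺
sign-elim P p⁺ p⁻ 1             = p⁻
sign-elim P p⁺ p⁻ (suc (suc i)) = subst P (sym (sign-period i)) (sign-elim P p⁺ p⁻ i)

-- The sign term has period two, and 2/3 of the difference 4 * 2^i - 2^i is 2^(i+1).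
ξ-period : ∀ i → ξ (2 + i) ≡ fromℕ (2 ^ suc i) ℚ.+ ξ i
ξ-period i = begin
  (+ 2 / 3) ℚ.* (fromℕ (2 * (2 * 2 ^ i)) ℚ.- z (2 + i))
    ≡⟨ cong₂ (λ a b → (+ 2 / 3) ℚ.* (a ℚ.- b))
         (trans (fromℕ-double (2 * 2 ^ i))
                (cong₂ ℚ._+_ (fromℕ-double (2 ^ i)) (fromℕ-double (2 ^ i))))
         (cong (λ s → (+ 3 ℤ.+ s) / 4) (sign-period i)) ⟩
  (+ 2 / 3) ℚ.* (((x ℚ.+ x) ℚ.+ (x ℚ.+ x)) ℚ.- z i)
    ≡⟨ solve 2 (λ x z → con (+ 2 / 3) :* (((x :+ x) :+ (x :+ x)) :- z)
                  := (x :+ x) :+ con (+ 2 / 3) :* (x :- z)) refl x (z i) ⟩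
  (x ℚ.+ x) ℚ.+ ξ i
    ≡⟨ cong (ℚ._+ ξ i) (fromℕ-double (2 ^ i)) ⟨
  fromℕ (2 ^ suc i) ℚ.+ ξ i ∎
  where
  open ≡-Reasoning
  open +-*-Solver
  x = fromℕ (2 ^ i)
  z : ℕ → ℚ
  z i = (+ 3 ℤ.+ -1ℤ ℤ.^ i) / 4

η-sum : ∀ i → η i ≡ (+ 1 / 3) ℚ.* (fromℕ (2 ^ suc i) ℚ.+ fromℤ (-1ℤ ℤ.^ i))
η-sum i = cong ((+ 1 / 3) ℚ.*_) (trans (fromℤ-+ (+ (2 ^ (i + 1))) (-1ℤ ℤ.^ i))
  (cong (λ n → fromℕ (2 ^ n) ℚ.+ fromℤ (-1ℤ ℤ.^ i)) (+-comm i 1)))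

η-period : ∀ i → η (2 + i) ≡ fromℕ (2 ^ suc i) ℚ.+ η i
η-period i = begin
  η (2 + i)
    ≡⟨ η-sum (2 + i) ⟩
  (+ 1 / 3) ℚ.* (fromℕ (2 * (2 * y)) ℚ.+ fromℤ (-1ℤ ℤ.^ (2 + i)))
    ≡⟨ cong₂ (λ a b → (+ 1 / 3) ℚ.* (a ℚ.+ fromℤ b))
         (trans (fromℕ-double (2 * y)) (cong₂ ℚ._+_ (fromℕ-double y) (fromℕ-double y)))
         (sign-period i) ⟩
  (+ 1 / 3) ℚ.* (((x ℚ.+ x) ℚ.+ (x ℚ.+ x)) ℚ.+ s)
    ≡⟨ solve 2 (λ x s → con (+ 1 / 3) :* (((x :+ x) :+ (x :+ x)) :+ s)
                  := x :+ con (+ 1 / 3) :* (x :+ s)) refl x s ⟩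
  x ℚ.+ (+ 1 / 3) ℚ.* (x ℚ.+ s)
    ≡⟨ cong (x ℚ.+_) (η-sum i) ⟨
  x ℚ.+ η i ∎
  where
  open ≡-Reasoning
  open +-*-Solver
  y = 2 ^ suc i
  x = fromℕ y
  s = fromℤ (-1ℤ ℤ.^ i)

ξ-ξℕ : ∀ i → ξ i ≡ fromℕ (ξℕ i)
ξ-ξℕ 0             = refl
ξ-ξℕ 1             = refl
ξ-ξℕ (suc (suc i)) = trans (ξ-period i)
  (trans (cong (fromℕ (2 ^ suc i) ℚ.+_) (ξ-ξℕ i)) (sym (fromℕ-+ (2 ^ suc i) (ξℕ i))))

η-ηℕ : ∀ i → η i ≡ fromℕ (ηℕ i)
η-ηℕ 0             = refl
η-ηℕ 1             = refl
η-ηℕ (suc (suc i)) = trans (η-period i)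
  (trans (cong (fromℕ (2 ^ suc i) ℚ.+_) (η-ηℕ i)) (sym (fromℕ-+ (2 ^ suc i) (ηℕ i))))

-- `ξ i` exceeds the argument of the ceiling by `c`, which is 0 for even `i` and 1/3 for odd `i`.
ξ-ceiling : ∀ i → ξ i ≡ fromℤ (ceiling ((+ 2 / 3) ℚ.* (fromℕ (2 ^ i) ℚ.- fromℕ 1)))
ξ-ceiling i = trans (ξ-ξℕ i) (cong fromℤ (sym (begin
  ceiling p
    ≡⟨ ceiling-floor p ⟩
  ℤ.- floor (ℚ.- p)
    ≡⟨ cong (λ q → ℤ.- floor q) -p≡ ⟩
  ℤ.- floor (fromℤ (ℤ.- (+ ξℕ i)) ℚ.+ c)
    ≡⟨ cong ℤ.-_ (floor-+ (ℤ.- (+ ξℕ i)) c c≥0 c<1) ⟩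
  ℤ.- ℤ.- (+ ξℕ i)
    ≡⟨ ℤ.neg-involutive (+ ξℕ i) ⟩
  + ξℕ i ∎)))
  where
  open ≡-Reasoning
  open +-*-Solver
  x = fromℕ (2 ^ i)
  z = (+ 3 ℤ.+ -1ℤ ℤ.^ i) / 4
  p = (+ 2 / 3) ℚ.* (x ℚ.- fromℕ 1)
  excess : ℤ → ℚ
  excess s = (+ 2 / 3) ℚ.* (1ℚ ℚ.- (+ 3 ℤ.+ s) / 4)
  c = excess (-1ℤ ℤ.^ i)
  c≥0 : 0ℚ ℚ.≤ c
  c≥0 = sign-elim (λ s → 0ℚ ℚ.≤ excess s)
    (from-yes (0ℚ ℚ.≤? excess 1ℤ)) (from-yes (0ℚ ℚ.≤? excess -1ℤ)) i
  c<1 : c ℚ.< 1ℚ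
  c<1 = sign-elim (λ s → excess s ℚ.< 1ℚ)
    (from-yes (excess 1ℤ ℚ.<? 1ℚ)) (from-yes (excess -1ℤ ℚ.<? 1ℚ)) i
  fromℤ-neg : ∀ n → fromℤ (ℤ.- (+ n)) ≡ ℚ.- fromℕ n
  fromℤ-neg zero    = refl
  fromℤ-neg (suc n) = refl
  -p≡ : ℚ.- p ≡ fromℤ (ℤ.- (+ ξℕ i)) ℚ.+ c
  -p≡ = begin
    ℚ.- p
      ≡⟨ solve 2 (λ x z → :- (con (+ 2 / 3) :* (x :- con 1ℚ)) :=
           :- (con (+ 2 / 3) :* (x :- z)) :+ con (+ 2 / 3) :* (con 1ℚ :- z)) refl x z ⟩
    ℚ.- ξ i ℚ.+ c
      ≡⟨ cong (λ y → ℚ.- y ℚ.+ c) (ξ-ξℕ i) ⟩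
    ℚ.- fromℕ (ξℕ i) ℚ.+ c
      ≡⟨ cong (ℚ._+ c) (fromℤ-neg (ξℕ i)) ⟨
    fromℤ (ℤ.- (+ ξℕ i)) ℚ.+ c ∎

-- The argument of the floor exceeds `η i` by `c`, which is 0 for even `i` and 2/3 for odd `i`.
η-floor : ∀ i → η i ≡ fromℤ (floor ((+ 1 / 3) ℚ.* (fromℕ (2 ^ (i + 1)) ℚ.+ fromℕ 1)))
η-floor i = trans (η-ηℕ i) (cong fromℤ (sym (trans (cong floor p≡)
  (floor-+ (+ ηℕ i) c c≥0 c<1))))
  where
  open ≡-Reasoning
  open +-*-Solver
  x = fromℕ (2 ^ suc i)
  s = fromℤ (-1ℤ ℤ.^ i)
  excess : ℤ → ℚ
  excess s = (+ 1 / 3) ℚ.* (1ℚ ℚ.- fromℤ s)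
  c = excess (-1ℤ ℤ.^ i)
  c≥0 : 0ℚ ℚ.≤ c
  c≥0 = sign-elim (λ s → 0ℚ ℚ.≤ excess s)
    (from-yes (0ℚ ℚ.≤? excess 1ℤ)) (from-yes (0ℚ ℚ.≤? excess -1ℤ)) i
  c<1 : c ℚ.< 1ℚ
  c<1 = sign-elim (λ s → excess s ℚ.< 1ℚ)
    (from-yes (excess 1ℤ ℚ.<? 1ℚ)) (from-yes (excess -1ℤ ℚ.<? 1ℚ)) i
  p≡ : (+ 1 / 3) ℚ.* (fromℕ (2 ^ (i + 1)) ℚ.+ fromℕ 1) ≡ fromℕ (ηℕ i) ℚ.+ c
  p≡ = begin
    (+ 1 / 3) ℚ.* (fromℕ (2 ^ (i + 1)) ℚ.+ fromℕ 1)
      ≡⟨ cong (λ n → (+ 1 / 3) ℚ.* (fromℕ (2 ^ n) ℚ.+ fromℕ 1)) (+-comm i 1) ⟩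
    (+ 1 / 3) ℚ.* (x ℚ.+ 1ℚ)
      ≡⟨ solve 2 (λ x s → con (+ 1 / 3) :* (x :+ con 1ℚ) :=
           con (+ 1 / 3) :* (x :+ s) :+ con (+ 1 / 3) :* (con 1ℚ :- s)) refl x s ⟩
    (+ 1 / 3) ℚ.* (x ℚ.+ s) ℚ.+ c
      ≡⟨ cong (ℚ._+ c) (trans (sym (η-sum i)) (η-ηℕ i)) ⟩
    fromℕ (ηℕ i) ℚ.+ c ∎

-- The upper bound and its attainment.

-- Here `n` and `n′` count the keys before and after contraction, and `x` the red nodes before. If
-- `n′` exceeds its least possible value `q` by `k`, then 2k red nodes are lost at the bottom and at
-- most k are gained above, so no `n′` beats `q`.
reds≤maxReds-quartered : ∀ {n} n′ x → Quartered n → 2 ≤ n → n ≤ 3 + n′ * 4 →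
  x + 2 * suc n′ ≤ maxReds n′ + suc n → x ≤ maxReds n
reds≤maxReds-quartered n′ x (quartered s q s<4) 2≤n n≤ x≤ = s≤s⁻¹
  (subst (suc x ≤_) (sym (maxReds-quarter s q s<4 2≤n))
    (+-cancelʳ-≤ (2 * suc n′ + 2 * q) (suc x) (s + 2 * q + maxReds q) (begin
      suc x + (2 * suc n′ + 2 * q)
        ≡⟨ regroup x n′ q ⟩
      x + 2 * suc n′ + suc (2 * q)
        ≤⟨ +-monoˡ-≤ (suc (2 * q)) x≤ ⟩
      maxReds n′ + suc (s + q * 4) + suc (2 * q)
        ≤⟨ +-monoˡ-≤ (suc (2 * q)) (+-monoˡ-≤ (suc (s + q * 4)) maxReds-n′≤) ⟩
      k + maxReds q + suc (s + q * 4) + suc (2 * q)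
        -- The slack `k` is this net loss.
        ≤⟨ m≤m+n _ k ⟩
      k + maxReds q + suc (s + q * 4) + suc (2 * q) + k
        ≡⟨ regroup′ k (maxReds q) s q ⟩
      s + 2 * q + maxReds q + (2 * suc (k + q) + 2 * q)
        ≡⟨ cong (λ m → s + 2 * q + maxReds q + (2 * suc m + 2 * q)) k+q≡n′ ⟩
      s + 2 * q + maxReds q + (2 * suc n′ + 2 * q) ∎)))
  where
  open ≤-Reasoning
  k = n′ ∸ q
  k+q≡n′ : k + q ≡ n′
  -- 4q ≤ n ≤ 3 + 4n′ < 4 (n′ + 1) gives q ≤ n′.
  k+q≡n′ = m∸n+n≡m (s≤s⁻¹ (*-cancelʳ-< 4 q (suc n′) (s≤s (≤-trans (m≤n+m (q * 4) s) n≤))))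
  maxReds-n′≤ : maxReds n′ ≤ k + maxReds q
  maxReds-n′≤ = subst (λ m → maxReds m ≤ k + maxReds q) k+q≡n′ (maxReds-+ k q)
  regroup : ∀ x n′ q → suc x + (2 * suc n′ + 2 * q) ≡ x + 2 * suc n′ + suc (2 * q)
  regroup = solve-∀
  regroup′ : ∀ k z s q → k + z + suc (s + q * 4) + suc (2 * q) + k ≡
    s + 2 * q + z + (2 * suc (k + q) + 2 * q)
  regroup′ = solve-∀

-- Covers `n` = 0 and 1, where the quarter recursion does not apply and `maxReds n` is `n` itself.
reds≤keys : ∀ n n′ x → x + 2 * suc n′ ≤ maxReds n′ + suc n → x ≤ n
reds≤keys n n′ x x≤ = ≤-trans (m≤m+n x (suc n′)) (+-cancelʳ-≤ (suc n′) (x + suc n′) n (begin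
  x + suc n′ + suc n′   ≡⟨ regroup x n′ ⟩
  x + 2 * suc n′        ≤⟨ x≤ ⟩
  maxReds n′ + suc n    ≤⟨ +-monoˡ-≤ (suc n) maxReds-n′≤n′ ⟩
  n′ + suc n            ≡⟨ regroup′ n′ n ⟩
  n + suc n′            ∎))
  where
  open ≤-Reasoning
  maxReds-n′≤n′ : maxReds n′ ≤ n′
  maxReds-n′≤n′ = subst (λ m → maxReds m ≤ m) (+-identityʳ n′) (maxReds-+ n′ 0)
  regroup : ∀ x n′ → x + suc n′ + suc n′ ≡ x + 2 * suc n′
  regroup = solve-∀
  regroup′ : ∀ n′ n → n′ + suc n ≡ n + suc n′
  regroup′ = solve-∀

reds≤maxReds-step : ∀ n n′ x → n ≤ 3 + n′ * 4 →
  x + 2 * suc n′ ≤ maxReds n′ + suc n → x ≤ maxReds n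
reds≤maxReds-step 0               n′ x _  x≤ = reds≤keys 0 n′ x x≤
reds≤maxReds-step 1               n′ x _  x≤ = reds≤keys 1 n′ x x≤
reds≤maxReds-step n@(suc (suc _)) n′ x n≤ x≤ =
  reds≤maxReds-quartered n′ x (quarters n) (s≤s (s≤s z≤n)) n≤ x≤

reds≤maxReds : ∀ {c h} (t : Shape c h) n → leaves t ≡ suc n → reds t ≤ maxReds n
reds≤maxReds {h = zero} nil               0 refl = z≤n
reds≤maxReds {h = zero} (redNode nil nil) 1 refl = ≤-refl
reds≤maxReds {h = suc h} t n lt
  -- Abstracting `leaves>0` together with the leaf count rules out the count 0.
  with leaves (strip t) in ls | leaves>0 (strip t) | leaves≤4*strip t | reds-strip t
... | suc n′ | _ | ≤4 | eq = reds≤maxReds-step n n′ (reds t)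
  (s≤s⁻¹ (subst₂ _≤_ lt (*-comm 4 (suc n′)) ≤4))
  (≤-trans (≤-reflexive (trans eq (cong (λ l → reds (strip t) + l) lt)))
           (+-monoˡ-≤ (suc n) (reds≤maxReds (strip t) n′ ls)))

Optimal : ℕ → Set
Optimal n = ∃[ c ] ∃[ h ] Σ[ t ∈ Shape c h ] leaves t ≡ suc n × reds t ≡ maxReds n

-- An optimal tree on `q` keys has q + 1 leaves; growing it with surplus s + 2q - 1 gives 4q + s + 1
-- leaves and adds exactly the red nodes that `maxReds-quarter` prescribes.
optimal : ∀ n → Optimal n
optimal = quarter-rec Optimal
  (black , 0 , nil , refl , refl)
  (red , 0 , redNode nil nil , refl , refl)
  step
  where
  surplus : ∀ s q → 2 ≤ s + q * 4 → ∃[ e ] suc e ≡ s + 2 * q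
  surplus zero    (suc q) _ = _ , refl
  surplus (suc s) q       _ = _ , refl
  regroup : ∀ s q → s + 2 * q + 2 * suc q ≡ suc (suc (s + q * 4))
  regroup = solve-∀
  step : ∀ s q → s < 4 → 2 ≤ s + q * 4 → Optimal q → Optimal (s + q * 4)
  step s q s<4 2≤n (c , h , t , lt , rt) with surplus s q 2≤n
  ... | e , 1+e≡ with grow t e e≤
    where
    e≤ : e ≤ 2 * leaves t
    -- The bound on the surplus is where the digit being at most 3 enters: 3 + 2q - 1 = 2 (q + 1).
    e≤ = s≤s⁻¹ (begin
      suc e             ≡⟨ 1+e≡ ⟩
      s + 2 * q         ≤⟨ +-monoˡ-≤ (2 * q) (s≤s⁻¹ s<4) ⟩
      3 + 2 * q         ≡⟨ cong suc (*-suc 2 q) ⟨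
      suc (2 * suc q)   ≡⟨ cong (λ l → suc (2 * l)) lt ⟨
      suc (2 * leaves t) ∎)
      where open ≤-Reasoning
  ...   | u , lu , ru = c , suc h , u ,
    suc-injective (begin
      suc (leaves u)           ≡⟨ cong suc lu ⟩
      suc e + 2 * leaves t     ≡⟨ cong₂ (λ a l → a + 2 * l) 1+e≡ lt ⟩
      s + 2 * q + 2 * suc q    ≡⟨ regroup s q ⟩
      suc (suc (s + q * 4))    ∎) ,
    suc-injective (begin
      suc (reds u)             ≡⟨ cong suc ru ⟩
      suc e + reds t           ≡⟨ cong₂ _+_ 1+e≡ rt ⟩
      s + 2 * q + maxReds q    ≡⟨ maxReds-quarter s q s<4 2≤n ⟨
      suc (maxReds (s + q * 4)) ∎)
    where open ≡-Reasoning

maxReds-isMaxReds : ∀ n → IsMaxReds n (maxReds n)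
maxReds-isMaxReds n = attained (optimal n) , bound
  where
  attained : Optimal n → ∃[ t ] RedBlackTreeOn n t × #reds t ≡ maxReds n
  attained (_ , _ , t , lt , rt) = toTree 0 t ,
    (toTree-isRedBlack 0 t , suc-injective (trans (sym (#nodes-toTree 0 t)) lt)) ,
    trans (#reds-toTree 0 t) rt
  bound : ∀ t → RedBlackTreeOn n t → #reds t ≤ maxReds n
  bound t (rb , refl) with shapeOf t rb
  ... | _ , _ , u = subst (_≤ maxReds n) (reds-eq u)
    (reds≤maxReds (shape u) n (leaves-suc u))

-- Reading off the rows of the table.

drop-2 : ∀ m u → m + (2 + u) ∸ 2 ≡ m + u
drop-2 m u = +-∸-assoc m {2 + u} {2} (s≤s (s≤s z≤n))

rows-small : ∀ i j → 1 ≤ j → j ≤ 2 ^ i → i < 2 → rows maxReds i j ≡ i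
rows-small 0 1 _ _ _ = refl
rows-small 1 1 _ _ _ = refl
rows-small 1 2 _ _ _ = refl
rows-small 0 (suc (suc _)) _ (s≤s ()) _
rows-small 1 (suc (suc (suc _))) _ (s≤s (s≤s ())) _
rows-small (suc (suc _)) _ _ _ (s≤s (s≤s ()))

rows-first : ∀ i → rows maxReds i 1 ≡ ξℕ i
rows-first i = trans (cong maxReds (cong (_∸ 2) (+-comm (2 ^ i) 1))) (maxReds-2^i∸1 i)

-- With j = 2 + u the index is 2^(p+1) + u and u < 2^p, so its leading binary digits are 10;
-- deleting the 0 gives the index of the same column one row up.
rows-left : ∀ p j → 2 ≤ j → j ≤ 2 ^ p →
  rows maxReds (suc p) j ≡ rows maxReds p j + ξℕ p
rows-left p (suc (suc u)) (s≤s (s≤s z≤n)) j≤ = begin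
  maxReds (2 ^ suc p + (2 + u) ∸ 2)    ≡⟨ cong maxReds (drop-2 (2 ^ suc p) u) ⟩
  maxReds (2 ^ suc p + u)              ≡⟨ maxReds-leading-10 p u (<⇒≤ j≤) ⟩
  maxReds (2 ^ p + u) + ξℕ p           ≡⟨ cong (λ n → maxReds n + ξℕ p) (drop-2 (2 ^ p) u) ⟨
  maxReds (2 ^ p + (2 + u) ∸ 2) + ξℕ p ∎
  where open ≡-Reasoning

rows-middle : ∀ p → rows maxReds (suc p) (2 ^ p + 1) ≡ 2 ^ suc p ∸ 1
rows-middle p = trans (cong maxReds (index (2 ^ suc p) (2 ^ p) (m^n>0 2 p))) (maxReds-middle p)
  where
  index : ∀ m n → 0 < n → m + (n + 1) ∸ 2 ≡ m + (n ∸ 1)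
  index m (suc n) _ = trans (cong (λ k → m + suc k ∸ 2) (+-comm n 1)) (drop-2 m n)

-- With j = 2^p + 2 + u the index is 3 * 2^p + u, with leading binary digits 11; deleting one 1
-- gives column 2 + u one row up.
rows-right : ∀ p j → 2 ^ p + 2 ≤ j → j ≤ 2 ^ suc p →
  rows maxReds (suc p) j ≡ rows maxReds p (j ∸ 2 ^ p) + ηℕ (suc p)
rows-right p j ≤j j≤ with m≤n⇒∃[o]m+o≡n ≤j
... | u , refl = begin
  maxReds (2 ^ suc p + (x + 2 + u) ∸ 2)
    ≡⟨ cong (λ n → maxReds (n ∸ 2)) (regroup x u) ⟩
  maxReds (3 * x + (2 + u) ∸ 2)
    ≡⟨ cong maxReds (drop-2 (3 * x) u) ⟩
  maxReds (3 * x + u)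
    ≡⟨ maxReds-leading-11 p u u<x ⟩
  maxReds (x + u) + ηℕ (suc p)
    ≡⟨ cong (λ n → maxReds n + ηℕ (suc p)) (drop-2 x u) ⟨
  maxReds (x + (2 + u) ∸ 2) + ηℕ (suc p)
    ≡⟨ cong (λ v → maxReds (x + v ∸ 2) + ηℕ (suc p))
         (trans (cong (_∸ x) (+-assoc x 2 u)) (m+n∸m≡n x (2 + u))) ⟨
  maxReds (x + (x + 2 + u ∸ x) ∸ 2) + ηℕ (suc p) ∎
  where
  open ≡-Reasoning
  x = 2 ^ p
  regroup : ∀ x u → 2 * x + (x + 2 + u) ≡ 3 * x + (2 + u)
  regroup = solve-∀
  u<x : u < x
  u<x = <⇒≤ (+-cancelˡ-≤ x (2 + u) x
    (subst₂ _≤_ (+-assoc x 2 u) (cong (λ y → x + y) (+-identityʳ x)) j≤))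

fromℕ-cong-+ : ∀ {a b c x} → a ≡ b + c → x ≡ fromℕ c → fromℕ a ≡ fromℕ b ℚ.+ x
fromℕ-cong-+ {b = b} {c} refl refl = fromℕ-+ b c

theorem3 : (∃[ r ] (∀ n → IsMaxReds n (r n)) ×
    (let t = rows r in
    ∀ i j → 1 ≤ j → j ≤ 2 ^ i →
    (i < 2 → t i j ≡ i) ×
    (2 ≤ i → j ≡ 1 → fromℕ (t i j) ≡ ξ i) ×
    (2 ≤ i → 2 ≤ j → j ≤ 2 ^ (i ∸ 1) →
    fromℕ (t i j) ≡ fromℕ (t (i ∸ 1) j) ℚ.+ ξ (i ∸ 1)) ×
    (2 ≤ i → j ≡ 2 ^ (i ∸ 1) + 1 → t i j ≡ 2 ^ i ∸ 1) ×
    (2 ≤ i → 2 ^ (i ∸ 1) + 2 ≤ j →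
    fromℕ (t i j) ≡ fromℕ (t (i ∸ 1) (j ∸ 2 ^ (i ∸ 1))) ℚ.+ η i))) ×
    (∀ i → ξ i ≡ fromℤ (ceiling ((+ 2 / 3) ℚ.* (fromℕ (2 ^ i) ℚ.- fromℕ 1)))) ×
    (∀ i → η i ≡ fromℤ (floor ((+ 1 / 3) ℚ.* (fromℕ (2 ^ (i + 1)) ℚ.+ fromℕ 1))))
theorem3 = (maxReds , maxReds-isMaxReds , table) , ξ-ceiling , η-floor
  where
  table : ∀ i j → 1 ≤ j → j ≤ 2 ^ i → _
  table i j 1≤j j≤ =
    rows-small i j 1≤j j≤ ,
    (λ { _ refl → trans (cong fromℕ (rows-first i)) (sym (ξ-ξℕ i)) }) ,
    -- Matching `2 ≤ i` exposes `i` as `suc p`, so that `i ∸ 1` reduces to `p`.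
    (λ { (s≤s {n = p} _) 2≤j j≤′ → fromℕ-cong-+ (rows-left p j 2≤j j≤′) (ξ-ξℕ p) }) ,
    (λ { (s≤s {n = p} _) refl → rows-middle p }) ,
    (λ { (s≤s {n = p} _) ≤j → fromℕ-cong-+ (rows-right p j ≤j j≤) (η-ηℕ (suc p)) })
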